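{- For all PAL formulas $\phi,\psi\in\mathcal{L}_{pal}$, every Kripke model $\mathcal{M}$ and every world $w$ of $\mathcal{M}$, $$(\mathcal{M},w)\models[\phi]^+_{Ag}\psi \iff (\mathcal{M},w)\models[\phi]\psi.$$
   Context: Languages. $AP$ is a set of atoms and $Ag$ a finite set of agents. For $p\in AP$ and $A\subseteq Ag$, the formulas of public announcement logic $\mathcal{L}_{pal}$ (PAL) are $\psi ::= p \mid \neg\psi \mid \psi\land\psi \mid C_A\psi \mid [\psi]\psi$. The operator $[\cdot]^+_{Ag}$ is the global announcement to the set $Ag$ of all agents; formulas $[\phi]^+_{Ag}\psi$ with $\phi,\psi\in\mathcal{L}_{pal}$ are interpreted by the clause below. Models. A (Kripke) model is $\mathcal{M}=\langle W,\{R_a\}_{a\in Ag},V\rangle$ with $W$ a set of worlds, each $R_a$ an equivalence relation on $W$, and $V:AP\to 2^W$. For $w\in W$, $R_a(w)=\{w' : R_a(w,w')\}$; for $A\subseteq Ag$, $R^C_A=(\bigcup_{a\in A}R_a)^*$ is the reflexive-transitive closure and $R^C_A(w)=\{w' : R^C_A(w,w')\}$. Semantics. The satisfaction set $[\![\varphi]\!]_{\mathcal{M}}\subseteq W$ is defined by: $[\![p]\!]_{\mathcal{M}}=V(p)$; $[\![\neg\psi]\!]_{\mathcal{M}}=W\setminus[\![\psi]\!]_{\mathcal{M}}$; $[\![\psi\land\psi']\!]_{\mathcal{M}}=[\![\psi]\!]_{\mathcal{M}}\cap[\![\psi']\!]_{\mathcal{M}}$; $[\![C_A\psi]\!]_{\mathcal{M}}=\{w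 : R^C_A(w)\subseteq[\![\psi]\!]_{\mathcal{M}}\}$; $[\![[\psi]\psi']\!]_{\mathcal{M}}=\{w : \text{if } w\in[\![\psi]\!]_{\mathcal{M}} \text{ then } w\in[\![\psi']\!]_{\mathcal{M}_\psi}\}$; and $[\![[\psi]^+_{Ag}\psi']\!]_{\mathcal{M}}=\{w : \text{if } w\in[\![\psi]\!]_{\mathcal{M}} \text{ then } w\in[\![\psi']\!]_{\mathcal{M}^+_{(w,\psi,Ag)}}\}$. The model $\mathcal{M}_\psi$ is the restriction of $\mathcal{M}$ to $[\![\psi]\!]_{\mathcal{M}}$: its worlds are $W\cap[\![\psi]\!]_{\mathcal{M}}$, its relations $R_a\cap([\![\psi]\!]_{\mathcal{M}}\times[\![\psi]\!]_{\mathcal{M}})$, its valuation $p\mapsto V(p)\cap[\![\psi]\!]_{\mathcal{M}}$. The refinement $\mathcal{M}^+_{(w,\psi,Ag)}$ has the same worlds and valuation as $\mathcal{M}$ and, for every $a\in Ag$, the relation $R^+_a$ with $R^+_a(v)=R_a(v)\cap[\![\psi]\!]_{\mathcal{M}}$ if $v\in R^C_{Ag}(w)\cap[\![\psi]\!]_{\mathcal{M}}$; $R^+_a(v)=R_a(v)\cap[\![\neg\psi]\!]_{\mathcal{M}}$ if $v\in R^C_{Ag}(w)\cap[\![\neg\psi]\!]_{\mathcal{M}}$; $R^+_a(v)=R_a(v)$ otherwise. We write $(\mathcal{M},w)\models\varphi$ for $w\in[\![\varphi]\!]_{\mathcal{M}}$. -}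

module Defs where

open import Axiom.ExcludedMiddle using (ExcludedMiddle)
open import Data.Empty using (⊥-elim)
open import Data.Fin.Base using (Fin)
open import Data.Fin.Subset using (Subset) renaming (_∈_ to _∈ₛ_; ⊤ to Ag)
open import Data.Fin.Subset.Properties using (∈⊤)
open import Data.Nat.Base using (ℕ)
open import Data.Product.Base using (Σ; ∃; _×_; _,_; proj₁)
open import Data.Sum.Base using (_⊎_; inj₁; inj₂)
open import Level using (Level; _⊔_; suc)
open import Relation.Binary.Core using (Rel)
open import Relation.Binary.Structures using (IsEquivalence)
open import Relation.Binary.Construct.Closure.ReflexiveTransitive using (Star; _◅_; _◅◅_; ε)
open import Relation.Nullary.Decidable.Core using (yes; no)
open import Relation.Nullary.Negation.Core using (¬_)
open import Relation.Unary using (Pred; _∈_; _∉_; _⊆_; _∩_; ∁)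

private
  variable
    a ℓ : Level

infixr 6 _∧′_
infixr 7 ¬′_ C[_]_ [_]_ [_]⁺_

-- The set of agents is Fin n, and Ag : Subset n is the set of all of them.

data PAL (AP : Set a) (n : ℕ) : Set a where
  atom  : AP → PAL AP n
  ¬′_   : PAL AP n → PAL AP n
  _∧′_  : PAL AP n → PAL AP n → PAL AP n
  C[_]_ : Subset n → PAL AP n → PAL AP n
  [_]_  : PAL AP n → PAL AP n → PAL AP n

-- The global announcement takes PAL formulas as arguments and does not nest.

data GlobalAnnouncement (AP : Set a) (n : ℕ) : Set a where
  [_]⁺_ : PAL AP n → PAL AP n → GlobalAnnouncement AP n

-- The semantic clauses make no use of the relations being equivalences, so
-- they are given over structures with arbitrary relations. Updates of models
-- are again models: see restrict-isEquivalence and refine-isEquivalence; the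
-- latter needs excluded middle, the definition of the refinement does not.

record Structure (AP : Set a) (n : ℕ) (ℓ : Level) : Set (a ⊔ suc ℓ) where
  field
    W : Set ℓ
    R : Fin n → Rel W ℓ
    V : AP → Pred W ℓ

  Rᶜ : Subset n → Rel W ℓ
  Rᶜ A = Star (λ v u → ∃ λ i → i ∈ₛ A × R i v u)

record Model (AP : Set a) (n : ℕ) (ℓ : Level) : Set (a ⊔ suc ℓ) where
  field
    structure     : Structure AP n ℓ

  open Structure structure public

  field
    isEquivalence : ∀ i → IsEquivalence (R i)

-- Worlds carry a proof of P, but neither R nor V inspects it: worlds with the
-- same first projection are indistinguishable.

module _ {AP : Set a} {n : ℕ} (M : Structure AP n ℓ) where

  open Structure M

  restrict : Pred W ℓ → Structure AP n ℓ
  restrict P = record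
    { W = Σ W P
    ; R = λ i (v , _) (u , _) → R i v u
    ; V = λ p (v , _) → v ∈ V p
    }

  -- Definition by cases on v, as a disjunction: each disjunct is the condition
  -- on v together with membership of u in the corresponding set.

  refine : W → Pred W ℓ → Structure AP n ℓ
  refine w P = record { W = W ; R = R⁺ ; V = V }
    where
    R⁺ : Fin n → Rel W ℓ
    R⁺ i v u =
        (v ∈ Rᶜ Ag w ∩ P   × u ∈ R i v ∩ P)
      ⊎ (v ∈ Rᶜ Ag w ∩ ∁ P × u ∈ R i v ∩ ∁ P)
      ⊎ ((v ∉ Rᶜ Ag w ∩ P × v ∉ Rᶜ Ag w ∩ ∁ P) × u ∈ R i v)

module _ {AP : Set a} {n : ℕ} where

  open Structure

  ⟦_⟧ : PAL AP n → (M : Structure AP n ℓ) → Pred (W M) ℓ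
  ⟦ atom p   ⟧ M = V M p
  ⟦ ¬′ ψ     ⟧ M = ∁ (⟦ ψ ⟧ M)
  ⟦ ψ ∧′ ψ′  ⟧ M = ⟦ ψ ⟧ M ∩ ⟦ ψ′ ⟧ M
  ⟦ C[ A ] ψ ⟧ M = λ w → Rᶜ M A w ⊆ ⟦ ψ ⟧ M
  ⟦ [ ψ ] ψ′ ⟧ M = λ w → (p : w ∈ ⟦ ψ ⟧ M) → (w , p) ∈ ⟦ ψ′ ⟧ (restrict M (⟦ ψ ⟧ M))

  ⟦_⟧⁺ : GlobalAnnouncement AP n → (M : Structure AP n ℓ) → Pred (W M) ℓ
  ⟦ [ ψ ]⁺ ψ′ ⟧⁺ M = λ w → w ∈ ⟦ ψ ⟧ M → w ∈ ⟦ ψ′ ⟧ (refine M w (⟦ ψ ⟧ M))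

  infix 4 _,_⊨_ _,_⊨⁺_

  _,_⊨_ : (M : Model AP n ℓ) → Model.W M → PAL AP n → Set ℓ
  M , w ⊨ φ = w ∈ ⟦ φ ⟧ (Model.structure M)

  _,_⊨⁺_ : (M : Model AP n ℓ) → Model.W M → GlobalAnnouncement AP n → Set ℓ
  M , w ⊨⁺ φ = w ∈ ⟦ φ ⟧⁺ (Model.structure M)

module _ {AP : Set a} {n : ℕ} (M : Model AP n ℓ) where

  open Model M
  private module E {i} = IsEquivalence (isEquivalence i)

  restrict-isEquivalence : ∀ P i → IsEquivalence (Structure.R (restrict structure P) i)
  restrict-isEquivalence P i = record { refl = E.refl ; sym = E.sym ; trans = E.trans }

  refine-isEquivalence : ExcludedMiddle ℓ → ∀ w P i →
                         IsEquivalence (Structure.R (refine structure w P) i)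
  refine-isEquivalence em w P i = record { refl = refl⁺ ; sym = sym⁺ ; trans = trans⁺ }
    where
    R⁺ : Rel W ℓ
    R⁺ = Structure.R (refine structure w P) i

    step : ∀ {v u} → Rᶜ Ag w v → R i v u → Rᶜ Ag w u
    step c r = c ◅◅ ((i , ∈⊤ , r) ◅ ε)

    outside : ∀ {v} → v ∉ Rᶜ Ag w ∩ P × v ∉ Rᶜ Ag w ∩ ∁ P → ¬ Rᶜ Ag w v
    outside (¬p , ¬q) c = ¬q (c , λ p → ¬p (c , p))

    refl⁺ : ∀ {v} → R⁺ v v
    refl⁺ {v} with em {Rᶜ Ag w v} | em {P v}
    ... | yes c | yes p = inj₁ ((c , p) , E.refl , p)
    ... | yes c | no ¬p = inj₂ (inj₁ ((c , ¬p) , E.refl , ¬p))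
    ... | no ¬c | _     = inj₂ (inj₂ (((λ z → ¬c (proj₁ z)) , λ z → ¬c (proj₁ z)) , E.refl))

    sym⁺ : ∀ {v u} → R⁺ v u → R⁺ u v
    sym⁺ (inj₁ ((c , p) , r , q))        = inj₁ ((step c r , q) , E.sym r , p)
    sym⁺ (inj₂ (inj₁ ((c , p) , r , q))) = inj₂ (inj₁ ((step c r , q) , E.sym r , p))
    sym⁺ (inj₂ (inj₂ (o , r)))           =
      inj₂ (inj₂ (((λ z → ¬c (proj₁ z)) , λ z → ¬c (proj₁ z)) , E.sym r))
      where
      ¬c : ¬ Rᶜ Ag w _
      ¬c c = outside o (step c (E.sym r))

    trans⁺ : ∀ {v u t} → R⁺ v u → R⁺ u t → R⁺ v t
    trans⁺ (inj₁ (h , r , _)) (inj₁ (_ , s , q)) = inj₁ (h , E.trans r s , q)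
    trans⁺ (inj₁ (_ , _ , p)) (inj₂ (inj₁ ((_ , ¬p) , _))) = ⊥-elim (¬p p)
    trans⁺ (inj₁ ((c , _) , r , _)) (inj₂ (inj₂ (o , _))) = ⊥-elim (outside o (step c r))
    trans⁺ (inj₂ (inj₁ (_ , _ , ¬p))) (inj₁ ((_ , p) , _)) = ⊥-elim (¬p p)
    trans⁺ (inj₂ (inj₁ (h , r , _))) (inj₂ (inj₁ (_ , s , q))) = inj₂ (inj₁ (h , E.trans r s , q))
    trans⁺ (inj₂ (inj₁ ((c , _) , r , _))) (inj₂ (inj₂ (o , _))) = ⊥-elim (outside o (step c r))
    trans⁺ (inj₂ (inj₂ (o , r))) (inj₁ ((c , _) , _)) = ⊥-elim (outside o (step c (E.sym r)))
    trans⁺ (inj₂ (inj₂ (o , r))) (inj₂ (inj₁ ((c , _) , _))) = ⊥-elim (outside o (step c (E.sym r)))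
    trans⁺ (inj₂ (inj₂ (o , r))) (inj₂ (inj₂ (_ , s))) = inj₂ (inj₂ (o , E.trans r s))

{-# OPTIONS --safe #-}

-- Truth of PAL formulas is invariant under bisimulation, and when w satisfies φ,
-- the refinement at w is bisimilar to the restriction to ⟦ φ ⟧: match v with
-- itself whenever v is reachable from w. At a reachable φ-world exactly the first
-- clause of the refined relation applies, and it is the restricted relation.

module Submission where

open import Level using (Level; _⊔_)
open import Data.Empty using (⊥-elim)
open import Data.Fin.Subset using () renaming (⊤ to Ag)
open import Data.Fin.Subset.Properties using (∈⊤)
open import Data.Nat.Base using (ℕ)
open import Data.Product.Base using (∃; _×_; _,_)
open import Data.Sum.Base using (inj₁; inj₂)
open import Function.Base using (flip)
open import Function.Bundles using (_⇔_; mk⇔)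
open import Relation.Binary.Core using (REL)
open import Relation.Binary.Construct.Closure.ReflexiveTransitive using (ε; _◅_; _◅◅_)
open import Relation.Binary.PropositionalEquality.Core using (_≡_; refl)
open import Relation.Unary using (Pred)
open import Defs

private
  variable
    a ℓ ℓ₁ ℓ₂ r : Level
    AP : Set a
    n : ℕ

open Structure

-- Relating structures rather than models keeps the argument constructive: relations of a refinement
-- are shown to be equivalences only under excluded middle.
record IsBisimulation {AP : Set a} {n : ℕ} (M : Structure AP n ℓ₁) (N : Structure AP n ℓ₂)
                      (_~_ : REL (W M) (W N) r) : Set (a ⊔ ℓ₁ ⊔ ℓ₂ ⊔ r) where
  field
    atomsˡ : ∀ {x y} p → x ~ y → V M p x → V N p y
    atomsʳ : ∀ {x y} p → x ~ y → V N p y → V M p x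
    forth  : ∀ {i x x′ y} → x ~ y → R M i x x′ → ∃ λ y′ → R N i y y′ × x′ ~ y′
    back   : ∀ {i x y y′} → x ~ y → R N i y y′ → ∃ λ x′ → R M i x x′ × x′ ~ y′

open IsBisimulation

module _ {M : Structure AP n ℓ₁} {N : Structure AP n ℓ₂} {_~_ : REL (W M) (W N) r} where

  converse : IsBisimulation M N _~_ → IsBisimulation N M (flip _~_)
  converse B = record
    { atomsˡ = atomsʳ B
    ; atomsʳ = atomsˡ B
    ; forth  = back B
    ; back   = forth B
    }

  -- Agreement of `P` and `Q` along `_~_` ensures that a matching successor survives the
  -- restriction.
  restrict-bisimulation : {P : Pred (W M) ℓ₁} {Q : Pred (W N) ℓ₂} →
                          (∀ {x y} → x ~ y → P x → Q y) → (∀ {x y} → x ~ y → Q y → P x) →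
                          IsBisimulation M N _~_ →
                          IsBisimulation (restrict M P) (restrict N Q)
                                         (λ (x , _) (y , _) → x ~ y)
  restrict-bisimulation P⇒Q Q⇒P B = record
    { atomsˡ = atomsˡ B
    ; atomsʳ = atomsʳ B
    ; forth  = λ { {x′ = _ , p} z s → let y′ , t , z′ = forth B z s in (y′ , P⇒Q z′ p) , t , z′ }
    ; back   = λ { {y′ = _ , q} z t → let x′ , s , z′ = back B z t in (x′ , Q⇒P z′ q) , s , z′ }
    }

  -- Common knowledge quantifies over all paths, so carrying its truth from `M` to `N` means pulling
  -- each path of `N` back, edge by edge.
  back-Rᶜ : IsBisimulation M N _~_ → ∀ {A x y y′} → x ~ y → Rᶜ N A y y′ →
            ∃ λ x′ → Rᶜ M A x x′ × x′ ~ y′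
  back-Rᶜ B z ε = _ , ε , z
  back-Rᶜ B z ((i , i∈A , t) ◅ ts) =
    let _  , s  , z₁ = back B z t
        x′ , ss , z₂ = back-Rᶜ B z₁ ts
    in x′ , (i , i∈A , s) ◅ ss , z₂

-- Induction on `ψ` with the structures left general, since announcements change them. Negation and
-- announced formulas reverse direction, which `converse` handles.
bisimulation-invariance : {M : Structure AP n ℓ₁} {N : Structure AP n ℓ₂}
                          {_~_ : REL (W M) (W N) r} → IsBisimulation M N _~_ →
                          ∀ ψ {x y} → x ~ y → ⟦ ψ ⟧ M x → ⟦ ψ ⟧ N y
bisimulation-invariance B (atom p) z h = atomsˡ B p z h
bisimulation-invariance B (¬′ ψ) z h k = h (bisimulation-invariance (converse B) ψ z k)
bisimulation-invariance B (ψ ∧′ ψ′) z (h , h′) =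
  bisimulation-invariance B ψ z h , bisimulation-invariance B ψ′ z h′
bisimulation-invariance B (C[ A ] ψ) z h ts =
  let _ , ss , z′ = back-Rᶜ B z ts in bisimulation-invariance B ψ z′ (h ss)
bisimulation-invariance B ([ ψ ] ψ′) z h q =
  bisimulation-invariance
    (restrict-bisimulation (bisimulation-invariance B ψ)
                           (bisimulation-invariance (converse B) ψ) B)
    -- The worlds compared are `x` and `y` paired with proofs of `ψ`; the restricted relation
    -- ignores these, so `z` still relates them.
    ψ′ z (h (bisimulation-invariance (converse B) ψ z q))

refine-restrict-bisimulation : (M : Structure AP n ℓ) (w : W M) (P : Pred (W M) ℓ) →
                               IsBisimulation (refine M w P) (restrict M P)
                                              (λ v (u , _) → v ≡ u × Rᶜ M Ag w v)
refine-restrict-bisimulation M w P = record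
  { atomsˡ = λ { _ (refl , _) h → h }
  ; atomsʳ = λ { _ (refl , _) h → h }
  ; forth  = λ
    { (refl , c) (inj₁ (_ , s , p′)) → (_ , p′) , s , refl , step c s
    -- The proof `p` stored in the restricted world refutes the second clause and, together with
    -- reachability `c`, the third.
    ; {y = _ , p} (refl , _) (inj₂ (inj₁ ((_ , ¬p) , _))) → ⊥-elim (¬p p)
    ; {y = _ , p} (refl , c) (inj₂ (inj₂ ((v∉ , _) , _))) → ⊥-elim (v∉ (c , p))
    }
  ; back   = λ { {y = _ , p} {y′ = _ , p′} (refl , c) s →
                 _ , inj₁ ((c , p) , s , p′) , refl , step c s }
  }
  where
  step : ∀ {i v u} → Rᶜ M Ag w v → R M i v u → Rᶜ M Ag w u
  step c s = c ◅◅ ((_ , ∈⊤ , s) ◅ ε)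

corollary3 : ∀ {a ℓ : Level} {AP : Set a} {n : ℕ} (φ ψ : PAL AP n)
    (M : Model AP n ℓ) (w : Model.W M) →
    (M , w ⊨⁺ [ φ ]⁺ ψ) ⇔ (M , w ⊨ [ φ ] ψ)
corollary3 φ ψ M w = mk⇔
  -- The empty path makes `w` reachable from itself, so `w` is related to `(w , p)`.
  (λ h p → bisimulation-invariance B ψ (refl , ε) (h p))
  (λ h p → bisimulation-invariance (converse B) ψ (refl , ε) (h p))
  where
  B = refine-restrict-bisimulation (Model.structure M) w (⟦ φ ⟧ (Model.structure M))
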